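{- If $\Gamma\vdash_n t:A$, then $[\![\Gamma]\!]=[\![A]\!]$, where $[\![-]\!]$ is the interpretation of contexts and types of the annotated language in a categorical model.
   Context: Fix a set $\mathbf{Q}$ of qubits and a set $\mathbf{G}$ of gates; each gate $G$ comes with a tuple $(q_1,\dots,q_n)$ of distinct qubits and a duration $d\in\mathbb{R}_{\ge0}$, written $(G,d,q_1,\dots,q_n)\in\mathbf{G}$. **Types and contexts of the annotated language.** Types: $A,B::=1\mid q\mid A\otimes B\mid\Box_dA$ ($q\in\mathbf{Q}$, $d\in\mathbb{R}$). Contexts are lists of graded declarations $x:^dA$, $d\in\mathbb{R}$; $d+\Gamma$ adds $d$ to every grade of $\Gamma$. **Normal constructor terms.** The judgement $\Gamma\vdash_n t:A$ is generated by: - $\vdash_n *:1$ (empty context); - $x:^0q\vdash_n x:q$ for $q\in\mathbf{Q}$; - from $\Gamma\vdash_n s:A$ and $\Delta\vdash_n t:B$ infer $\Gamma,\Delta\vdash_n(s,t):A\otimes B$; - from $\Gamma\vdash_n t:A$ infer $d+\Gamma\vdash_n\mathrm{box}\ d\ t:\Box_dA$. **Categorical model of the annotated language.** This consists of: a symmetric monoidal category $\mathcal{C}^\otimes$ with unit $I$; for every $q\in\mathbf{Q}$ an object $X_q$; a monoidal functor $\mathrm{Shift}(-)$ from the discrete category of real numbers (monoidal under $+$) to the category of symmetric monoidal endofunctors of $\mathcal{C}^\otimes$ (so there are coherent natural isomorphisms $\mathrm{Shift}(0)(X)\simeq X$, $\mathrm{Shift}(d_1+d_2)(X)\simeq\mathrm{Shift}(d_1)(\mathrm{Shift}(d_2)(X))$,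 $\mathrm{Shift}(d)(I)\simeq I$, $\mathrm{Shift}(d)(X\otimes Y)\simeq\mathrm{Shift}(d)(X)\otimes\mathrm{Shift}(d)(Y)$); for every gate $(G,d,q_1,\dots,q_n)$ a morphism $f_G:\mathrm{Shift}(-d)(\bigotimes_iX_{q_i})\to\bigotimes_iX_{q_i}$; for every $x\in\mathbb{R}$ and $q\in\mathbf{Q}$ a morphism $\mathrm{delay}_x:\mathrm{Shift}(-x)(X_q)\to X_q$. **Interpretation.** $[\![1]\!]:=I$, $[\![q]\!]:=X_q$, $[\![A\otimes B]\!]:=[\![A]\!]\otimes[\![B]\!]$, $[\![\Box_dA]\!]:=\mathrm{Shift}(d)[\![A]\!]$; for contexts, $[\![[]]\!]:=I$ and $[\![x:^dA,\Gamma]\!]:=\mathrm{Shift}(d)[\![A]\!]\otimes[\![\Gamma]\!]$. Monoidality of $\mathrm{Shift}(d)$ gives $[\![d+\Gamma]\!]\simeq\mathrm{Shift}(d)[\![\Gamma]\!]$; in the interpretation of judgements such coherence isomorphisms are inserted where appropriate. -}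

module Defs where

open import Level using (Level; _⊔_) renaming (suc to lsuc)
open import Data.List.Base using (List; []; _∷_; _++_; map)
open import Data.List.Relation.Binary.Pointwise.Base using (Pointwise)
open import Data.Nat.Base as ℕ using (ℕ)
import Data.Nat.Properties as ℕ
open import Data.Product.Base using (∃-syntax; _×_; _,_)
open import Data.Rational.Base as ℚ using (ℚ; 0ℚ; ½; ∣_∣)
import Data.Rational.Properties as ℚ
open import Data.Rational.Solver using (module +-*-Solver)
open import Data.Vec.Base as Vec using (Vec)
open import Data.Vec.Relation.Unary.Unique.Propositional using (Unique)
open import Relation.Binary.Bundles using (Setoid)
open import Relation.Binary.PropositionalEquality
  using (_≡_; refl; sym; trans; cong; subst)
open import Relation.Binary.Structures using (IsEquivalence)
import Relation.Binary.Reasoning.Setoid as SetoidReasoning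

-- The real numbers, as rational Cauchy sequences (with modulus) up to
-- the setoid equality ≈ℝ; the sequences themselves are never compared
-- with ≡.

record ℝ : Set where
  constructor mkℝ
  field
    seq    : ℕ → ℚ
    cauchy : ∀ ε → 0ℚ ℚ.< ε →
             ∃[ N ] ∀ m n → N ℕ.≤ m → N ℕ.≤ n → ∣ seq m ℚ.- seq n ∣ ℚ.≤ ε

open ℝ public using (seq; cauchy)

infix  4 _≈ℝ_ 0≤ℝ_
infixl 6 _+ℝ_
infix  8 -ℝ_

record _≈ℝ_ (x y : ℝ) : Set where
  constructor mk≈
  field
    close : ∀ ε → 0ℚ ℚ.< ε →
            ∃[ N ] ∀ n → N ℕ.≤ n → ∣ seq x n ℚ.- seq y n ∣ ℚ.≤ ε

open _≈ℝ_ public using (close)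

0≤ℝ_ : ℝ → Set
0≤ℝ x = ∀ ε → 0ℚ ℚ.< ε → ∃[ N ] ∀ n → N ℕ.≤ n → ℚ.- ε ℚ.≤ seq x n

-- abstract: unfolding the ring solver's proofs makes type checking slow
private abstract
  half>0 : ∀ {ε} → 0ℚ ℚ.< ε → 0ℚ ℚ.< ½ ℚ.* ε
  half>0 {ε} 0<ε =
    subst (ℚ._< ½ ℚ.* ε) (ℚ.*-zeroʳ ½) (ℚ.*-monoʳ-<-pos ½ 0<ε)

  halves : ∀ ε → ½ ℚ.* ε ℚ.+ ½ ℚ.* ε ≡ ε
  halves ε = trans (sym (ℚ.*-distribʳ-+ ε ½ ½)) (ℚ.*-identityˡ ε)

  ∣p-p∣≤ : ∀ p {ε} → 0ℚ ℚ.< ε → ∣ p ℚ.- p ∣ ℚ.≤ ε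
  ∣p-p∣≤ p {ε} 0<ε =
    subst (λ z → ∣ z ∣ ℚ.≤ ε) (sym (ℚ.+-inverseʳ p)) (ℚ.<⇒≤ 0<ε)

  ∣+∣≤ : ∀ {p q r} ε → r ≡ p ℚ.+ q →
         ∣ p ∣ ℚ.≤ ½ ℚ.* ε → ∣ q ∣ ℚ.≤ ½ ℚ.* ε → ∣ r ∣ ℚ.≤ ε
  ∣+∣≤ {p} {q} ε refl p≤ q≤ =
    ℚ.≤-trans (ℚ.∣p+q∣≤∣p∣+∣q∣ p q)
      (subst (∣ p ∣ ℚ.+ ∣ q ∣ ℚ.≤_) (halves ε) (ℚ.+-mono-≤ p≤ q≤))

  ∣-swap∣ : ∀ p q → ∣ p ℚ.- q ∣ ≡ ∣ q ℚ.- p ∣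
  ∣-swap∣ p q = trans (cong ∣_∣ eq) (ℚ.∣-p∣≡∣p∣ (q ℚ.- p))
    where
    open +-*-Solver
    eq : p ℚ.- q ≡ ℚ.- (q ℚ.- p)
    eq = solve 2 (λ a b → a :- b := :- (b :- a)) refl p q

  -‿interchange : ∀ p q r s →
                  (p ℚ.+ q) ℚ.- (r ℚ.+ s) ≡ (p ℚ.- r) ℚ.+ (q ℚ.- s)
  -‿interchange = solve 4
    (λ p q r s → (p :+ q) :- (r :+ s) := (p :- r) :+ (q :- s)) refl
    where open +-*-Solver

  pointwise : ∀ x y → (∀ n → seq x n ≡ seq y n) → x ≈ℝ y
  pointwise x y eq = mk≈ λ ε 0<ε → 0 , λ n _ →
    subst (λ z → ∣ seq x n ℚ.- z ∣ ℚ.≤ ε) (eq n) (∣p-p∣≤ (seq x n) 0<ε)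

  ∣neg-neg∣ : ∀ a b → ∣ a ℚ.- b ∣ ≡ ∣ (ℚ.- a) ℚ.- (ℚ.- b) ∣
  ∣neg-neg∣ a b = trans (∣-swap∣ a b)
    (cong ∣_∣ (solve 2 (λ a b → b :- a := :- a :- (:- b)) refl a b))
    where open +-*-Solver

  -‿split : ∀ a b c → a ℚ.- c ≡ (a ℚ.- b) ℚ.+ (b ℚ.- c)
  -‿split = solve 3 (λ a b c → a :- c := (a :- b) :+ (b :- c)) refl
    where open +-*-Solver

0ℝ : ℝ
0ℝ = mkℝ (λ _ → 0ℚ) λ ε 0<ε → 0 , λ _ _ _ _ → ℚ.<⇒≤ 0<ε

_+ℝ_ : ℝ → ℝ → ℝ
x +ℝ y = mkℝ (λ n → seq x n ℚ.+ seq y n) λ ε 0<ε →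
  let M , p = cauchy x (½ ℚ.* ε) (half>0 0<ε)
      N , q = cauchy y (½ ℚ.* ε) (half>0 0<ε)
  in M ℕ.⊔ N , λ m n h k →
     ∣+∣≤ ε (-‿interchange (seq x m) (seq y m) (seq x n) (seq y n))
       (p m n (ℕ.m⊔n≤o⇒m≤o M N h) (ℕ.m⊔n≤o⇒m≤o M N k))
       (q m n (ℕ.m⊔n≤o⇒n≤o M N h) (ℕ.m⊔n≤o⇒n≤o M N k))

-ℝ_ : ℝ → ℝ
-ℝ x = mkℝ (λ n → ℚ.- seq x n) λ ε 0<ε →
  let N , p = cauchy x ε 0<ε
  in N , λ m n h k → subst (ℚ._≤ ε) (∣neg-neg∣ (seq x m) (seq x n)) (p m n h k)

≈ℝ-refl : ∀ {x} → x ≈ℝ x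
≈ℝ-refl {x} = pointwise x x (λ _ → refl)

≈ℝ-sym : ∀ {x y} → x ≈ℝ y → y ≈ℝ x
≈ℝ-sym {x} {y} p = mk≈ λ ε 0<ε →
  let N , h = close p ε 0<ε
  in N , λ n k → subst (ℚ._≤ ε) (∣-swap∣ (seq x n) (seq y n)) (h n k)

≈ℝ-trans : ∀ {x y z} → x ≈ℝ y → y ≈ℝ z → x ≈ℝ z
≈ℝ-trans {x} {y} {z} p q = mk≈ λ ε 0<ε →
  let M , h = close p (½ ℚ.* ε) (half>0 0<ε)
      N , k = close q (½ ℚ.* ε) (half>0 0<ε)
  in M ℕ.⊔ N , λ n l →
     ∣+∣≤ ε (-‿split (seq x n) (seq y n) (seq z n))
       (h n (ℕ.m⊔n≤o⇒m≤o M N l)) (k n (ℕ.m⊔n≤o⇒n≤o M N l))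

+ℝ-cong : ∀ {x x′ y y′} → x ≈ℝ x′ → y ≈ℝ y′ → x +ℝ y ≈ℝ x′ +ℝ y′
+ℝ-cong {x} {x′} {y} {y′} p q = mk≈ λ ε 0<ε →
  let M , h = close p (½ ℚ.* ε) (half>0 0<ε)
      N , k = close q (½ ℚ.* ε) (half>0 0<ε)
  in M ℕ.⊔ N , λ n l →
     ∣+∣≤ ε (-‿interchange (seq x n) (seq y n) (seq x′ n) (seq y′ n))
       (h n (ℕ.m⊔n≤o⇒m≤o M N l)) (k n (ℕ.m⊔n≤o⇒n≤o M N l))

-ℝ-cong : ∀ {x y} → x ≈ℝ y → -ℝ x ≈ℝ -ℝ y
-ℝ-cong {x} {y} p = mk≈ λ ε 0<ε →
  let N , h = close p ε 0<ε
  in N , λ n k → subst (ℚ._≤ ε) (∣neg-neg∣ (seq x n) (seq y n)) (h n k)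

+ℝ-assoc : ∀ x y z → (x +ℝ y) +ℝ z ≈ℝ x +ℝ (y +ℝ z)
+ℝ-assoc x y z = pointwise ((x +ℝ y) +ℝ z) (x +ℝ (y +ℝ z))
  λ n → ℚ.+-assoc (seq x n) (seq y n) (seq z n)

+ℝ-identityˡ : ∀ x → 0ℝ +ℝ x ≈ℝ x
+ℝ-identityˡ x = pointwise (0ℝ +ℝ x) x λ n → ℚ.+-identityˡ (seq x n)

+ℝ-identityʳ : ∀ x → x +ℝ 0ℝ ≈ℝ x
+ℝ-identityʳ x = pointwise (x +ℝ 0ℝ) x λ n → ℚ.+-identityʳ (seq x n)

record Category (o ℓ e : Level) : Set (lsuc (o ⊔ ℓ ⊔ e)) where
  infix  4 _⇒_ _≈_
  infixr 9 _∘_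
  field
    Obj       : Set o
    _⇒_       : Obj → Obj → Set ℓ
    _≈_       : ∀ {X Y} → X ⇒ Y → X ⇒ Y → Set e
    id        : ∀ {X} → X ⇒ X
    _∘_       : ∀ {X Y Z} → Y ⇒ Z → X ⇒ Y → X ⇒ Z
    assoc     : ∀ {W X Y Z} {f : W ⇒ X} {g : X ⇒ Y} {h : Y ⇒ Z} →
                (h ∘ g) ∘ f ≈ h ∘ (g ∘ f)
    identityˡ : ∀ {X Y} {f : X ⇒ Y} → id ∘ f ≈ f
    identityʳ : ∀ {X Y} {f : X ⇒ Y} → f ∘ id ≈ f
    equiv     : ∀ {X Y} → IsEquivalence (_≈_ {X} {Y})
    ∘-resp-≈  : ∀ {X Y Z} {f f′ : Y ⇒ Z} {g g′ : X ⇒ Y} →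
                f ≈ f′ → g ≈ g′ → f ∘ g ≈ f′ ∘ g′

  module Equiv {X Y} = IsEquivalence (equiv {X} {Y})

  homSetoid : Obj → Obj → Setoid ℓ e
  homSetoid X Y = record { Carrier = X ⇒ Y ; _≈_ = _≈_ ; isEquivalence = equiv }

  module HomReasoning {X Y} = SetoidReasoning (homSetoid X Y)

  ∘-resp-≈ˡ : ∀ {X Y Z} {f f′ : Y ⇒ Z} {g : X ⇒ Y} → f ≈ f′ → f ∘ g ≈ f′ ∘ g
  ∘-resp-≈ˡ p = ∘-resp-≈ p Equiv.refl

  ∘-resp-≈ʳ : ∀ {X Y Z} {f : Y ⇒ Z} {g g′ : X ⇒ Y} → g ≈ g′ → f ∘ g ≈ f ∘ g′
  ∘-resp-≈ʳ p = ∘-resp-≈ Equiv.refl p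

  pullˡ : ∀ {W X Y Z} {f : Y ⇒ Z} {g : X ⇒ Y} {h : W ⇒ X} {k : X ⇒ Z} →
          f ∘ g ≈ k → f ∘ (g ∘ h) ≈ k ∘ h
  pullˡ p = Equiv.trans (Equiv.sym assoc) (∘-resp-≈ˡ p)

  cancelInner : ∀ {W X Y Z} {f : Y ⇒ Z} {g : X ⇒ Y} {g⁻¹ : Y ⇒ X} {h : W ⇒ Y} →
                g ∘ g⁻¹ ≈ id → (f ∘ g) ∘ (g⁻¹ ∘ h) ≈ f ∘ h
  cancelInner p =
    Equiv.trans assoc (∘-resp-≈ʳ (Equiv.trans (pullˡ p) identityˡ))

  infix 4 _≅_
  record _≅_ (X Y : Obj) : Set (ℓ ⊔ e) where
    field
      from : X ⇒ Y
      to   : Y ⇒ X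
      isoˡ : to ∘ from ≈ id
      isoʳ : from ∘ to ≈ id

  open _≅_ public

  ≅-refl : ∀ {X} → X ≅ X
  ≅-refl = record { from = id ; to = id ; isoˡ = identityˡ ; isoʳ = identityˡ }

  ≅-sym : ∀ {X Y} → X ≅ Y → Y ≅ X
  ≅-sym i = record { from = to i ; to = from i ; isoˡ = isoʳ i ; isoʳ = isoˡ i }

  ≅-trans : ∀ {X Y Z} → X ≅ Y → Y ≅ Z → X ≅ Z
  ≅-trans i j = record
    { from = from j ∘ from i
    ; to   = to i ∘ to j
    ; isoˡ = Equiv.trans (cancelInner (isoˡ j)) (isoˡ i)
    ; isoʳ = Equiv.trans (cancelInner (isoʳ i)) (isoʳ j)
    }

record SymmetricMonoidalCategory (o ℓ e : Level) : Set (lsuc (o ⊔ ℓ ⊔ e)) where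
  field
    category : Category o ℓ e

  open Category category public

  infixr 10 _⊗₀_ _⊗₁_
  field
    unit : Obj
    _⊗₀_ : Obj → Obj → Obj
    _⊗₁_ : ∀ {X X′ Y Y′} → X ⇒ X′ → Y ⇒ Y′ → X ⊗₀ Y ⇒ X′ ⊗₀ Y′

    ⊗-identity     : ∀ {X Y} → id {X} ⊗₁ id {Y} ≈ id
    ⊗-homomorphism : ∀ {X X′ X″ Y Y′ Y″}
                     {f : X ⇒ X′} {f′ : X′ ⇒ X″} {g : Y ⇒ Y′} {g′ : Y′ ⇒ Y″} →
                     (f′ ∘ f) ⊗₁ (g′ ∘ g) ≈ (f′ ⊗₁ g′) ∘ (f ⊗₁ g)
    ⊗-resp-≈       : ∀ {X X′ Y Y′} {f f′ : X ⇒ X′} {g g′ : Y ⇒ Y′} →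
                     f ≈ f′ → g ≈ g′ → f ⊗₁ g ≈ f′ ⊗₁ g′

    associator : ∀ X Y Z → (X ⊗₀ Y) ⊗₀ Z ≅ X ⊗₀ (Y ⊗₀ Z)
    unitorˡ    : ∀ X → unit ⊗₀ X ≅ X
    unitorʳ    : ∀ X → X ⊗₀ unit ≅ X
    braiding   : ∀ X Y → X ⊗₀ Y ≅ Y ⊗₀ X

  α : ∀ {X Y Z} → (X ⊗₀ Y) ⊗₀ Z ⇒ X ⊗₀ (Y ⊗₀ Z)
  α = from (associator _ _ _)

  λ⇒ : ∀ {X} → unit ⊗₀ X ⇒ X
  λ⇒ = from (unitorˡ _)

  ρ⇒ : ∀ {X} → X ⊗₀ unit ⇒ X
  ρ⇒ = from (unitorʳ _)

  σ : ∀ {X Y} → X ⊗₀ Y ⇒ Y ⊗₀ X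
  σ = from (braiding _ _)

  field
    α-natural : ∀ {X X′ Y Y′ Z Z′} {f : X ⇒ X′} {g : Y ⇒ Y′} {h : Z ⇒ Z′} →
                α ∘ ((f ⊗₁ g) ⊗₁ h) ≈ (f ⊗₁ (g ⊗₁ h)) ∘ α
    λ-natural : ∀ {X X′} {f : X ⇒ X′} → λ⇒ ∘ (id ⊗₁ f) ≈ f ∘ λ⇒
    ρ-natural : ∀ {X X′} {f : X ⇒ X′} → ρ⇒ ∘ (f ⊗₁ id) ≈ f ∘ ρ⇒
    σ-natural : ∀ {X X′ Y Y′} {f : X ⇒ X′} {g : Y ⇒ Y′} →
                σ ∘ (f ⊗₁ g) ≈ (g ⊗₁ f) ∘ σ

    triangle : ∀ {X Y} → (id {X} ⊗₁ λ⇒ {Y}) ∘ α ≈ ρ⇒ ⊗₁ id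
    pentagon : ∀ {W X Y Z} →
               (id {W} ⊗₁ α {X} {Y} {Z}) ∘ α ∘ (α ⊗₁ id) ≈ α ∘ α
    hexagon  : ∀ {X Y Z} →
               (id ⊗₁ σ) ∘ α ∘ (σ {X} {Y} ⊗₁ id {Z}) ≈ α ∘ σ ∘ α
    σ-involutive : ∀ {X Y} → σ ∘ σ {X} {Y} ≈ id

  _⊗ᵢ_ : ∀ {X X′ Y Y′} → X ≅ X′ → Y ≅ Y′ → X ⊗₀ Y ≅ X′ ⊗₀ Y′
  i ⊗ᵢ j = record
    { from = from i ⊗₁ from j
    ; to   = to i ⊗₁ to j
    ; isoˡ = inv (isoˡ i) (isoˡ j)
    ; isoʳ = inv (isoʳ i) (isoʳ j)
    }
    where
    inv : ∀ {X X′ Y Y′} {f : X ⇒ X′} {f⁻¹ : X′ ⇒ X} {g : Y ⇒ Y′} {g⁻¹ : Y′ ⇒ Y} →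
          f⁻¹ ∘ f ≈ id → g⁻¹ ∘ g ≈ id → (f⁻¹ ⊗₁ g⁻¹) ∘ (f ⊗₁ g) ≈ id
    inv p q = Equiv.trans (Equiv.sym ⊗-homomorphism)
                (Equiv.trans (⊗-resp-≈ p q) ⊗-identity)

  ⨂ : ∀ {n} → Vec Obj n → Obj
  ⨂ = Vec.foldr′ _⊗₀_ unit

module Endofunctors {o ℓ e} (C : SymmetricMonoidalCategory o ℓ e) where
  open SymmetricMonoidalCategory C

  record SymmetricMonoidalEndofunctor : Set (o ⊔ ℓ ⊔ e) where
    field
      F₀           : Obj → Obj
      F₁           : ∀ {X Y} → X ⇒ Y → F₀ X ⇒ F₀ Y
      F-identity   : ∀ {X} → F₁ (id {X}) ≈ id
      homomorphism : ∀ {X Y Z} {f : X ⇒ Y} {g : Y ⇒ Z} →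
                     F₁ (g ∘ f) ≈ F₁ g ∘ F₁ f
      F-resp-≈     : ∀ {X Y} {f g : X ⇒ Y} → f ≈ g → F₁ f ≈ F₁ g

      ε-iso : unit ≅ F₀ unit
      φ-iso : ∀ X Y → F₀ X ⊗₀ F₀ Y ≅ F₀ (X ⊗₀ Y)

    ε : unit ⇒ F₀ unit
    ε = from ε-iso

    φ : ∀ {X Y} → F₀ X ⊗₀ F₀ Y ⇒ F₀ (X ⊗₀ Y)
    φ = from (φ-iso _ _)

    field
      φ-natural     : ∀ {X X′ Y Y′} {f : X ⇒ X′} {g : Y ⇒ Y′} →
                      φ ∘ (F₁ f ⊗₁ F₁ g) ≈ F₁ (f ⊗₁ g) ∘ φ
      associativity : ∀ {X Y Z} →
                      F₁ (α {X} {Y} {Z}) ∘ φ ∘ (φ ⊗₁ id) ≈ φ ∘ (id ⊗₁ φ) ∘ α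
      unitaryˡ      : ∀ {X} → F₁ (λ⇒ {X}) ∘ φ ∘ (ε ⊗₁ id) ≈ λ⇒
      unitaryʳ      : ∀ {X} → F₁ (ρ⇒ {X}) ∘ φ ∘ (id ⊗₁ ε) ≈ ρ⇒
      symmetry      : ∀ {X Y} → F₁ (σ {X} {Y}) ∘ φ ≈ φ ∘ σ

    Fᵢ : ∀ {X Y} → X ≅ Y → F₀ X ≅ F₀ Y
    Fᵢ i = record
      { from = F₁ (from i)
      ; to   = F₁ (to i)
      ; isoˡ = inv (isoˡ i)
      ; isoʳ = inv (isoʳ i)
      }
      where
      inv : ∀ {X Y} {f : X ⇒ Y} {g : Y ⇒ X} → g ∘ f ≈ id → F₁ g ∘ F₁ f ≈ id
      inv p = Equiv.trans (Equiv.sym homomorphism)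
                (Equiv.trans (F-resp-≈ p) F-identity)

  open SymmetricMonoidalEndofunctor

  idF : SymmetricMonoidalEndofunctor
  idF = record
    { F₀            = λ X → X
    ; F₁            = λ f → f
    ; F-identity    = Equiv.refl
    ; homomorphism  = Equiv.refl
    ; F-resp-≈      = λ p → p
    ; ε-iso         = ≅-refl
    ; φ-iso         = λ _ _ → ≅-refl
    ; φ-natural     = Equiv.trans identityˡ (Equiv.sym identityʳ)
    ; associativity = Equiv.trans (∘-resp-≈ʳ (Equiv.trans identityˡ ⊗-identity))
                        (Equiv.trans identityʳ (Equiv.sym
                          (Equiv.trans identityˡ
                            (Equiv.trans (∘-resp-≈ˡ ⊗-identity) identityˡ))))
    ; unitaryˡ      = Equiv.trans (∘-resp-≈ʳ (Equiv.trans identityˡ ⊗-identity))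
                        identityʳ
    ; unitaryʳ      = Equiv.trans (∘-resp-≈ʳ (Equiv.trans identityˡ ⊗-identity))
                        identityʳ
    ; symmetry      = Equiv.trans identityʳ (Equiv.sym identityˡ)
    }

  infixr 9 _∘F_
  _∘F_ : SymmetricMonoidalEndofunctor → SymmetricMonoidalEndofunctor →
         SymmetricMonoidalEndofunctor
  G ∘F F = record
    { F₀            = λ X → G.F₀ (F.F₀ X)
    ; F₁            = λ f → G.F₁ (F.F₁ f)
    ; F-identity    = Equiv.trans (G.F-resp-≈ F.F-identity) G.F-identity
    ; homomorphism  = Equiv.trans (G.F-resp-≈ F.homomorphism) G.homomorphism
    ; F-resp-≈      = λ p → G.F-resp-≈ (F.F-resp-≈ p)
    ; ε-iso         = ≅-trans G.ε-iso (G.Fᵢ F.ε-iso)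
    ; φ-iso         = λ X Y → ≅-trans (G.φ-iso _ _) (G.Fᵢ (F.φ-iso X Y))
    ; φ-natural     = φ-nat
    ; associativity = assoc-law
    ; unitaryˡ      = unitˡ-law
    ; unitaryʳ      = unitʳ-law
    ; symmetry      = Equiv.trans (pullˡ (Equiv.sym G.homomorphism))
                        (Equiv.trans (∘-resp-≈ˡ (G.F-resp-≈ F.symmetry))
                          (Equiv.trans (∘-resp-≈ˡ G.homomorphism)
                            (Equiv.trans assoc
                              (Equiv.trans (∘-resp-≈ʳ G.symmetry)
                                (Equiv.sym assoc)))))
    }
    where
    module G = SymmetricMonoidalEndofunctor G
    module F = SymmetricMonoidalEndofunctor F
    open HomReasoning

    φ-nat : ∀ {X X′ Y Y′} {f : X ⇒ X′} {g : Y ⇒ Y′} →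
            (G.F₁ F.φ ∘ G.φ) ∘ (G.F₁ (F.F₁ f) ⊗₁ G.F₁ (F.F₁ g)) ≈
            G.F₁ (F.F₁ (f ⊗₁ g)) ∘ (G.F₁ F.φ ∘ G.φ)
    φ-nat {f = f} {g} = begin
      (G.F₁ F.φ ∘ G.φ) ∘ (G.F₁ (F.F₁ f) ⊗₁ G.F₁ (F.F₁ g))
        ≈⟨ assoc ⟩
      G.F₁ F.φ ∘ G.φ ∘ (G.F₁ (F.F₁ f) ⊗₁ G.F₁ (F.F₁ g))
        ≈⟨ ∘-resp-≈ʳ G.φ-natural ⟩
      G.F₁ F.φ ∘ G.F₁ (F.F₁ f ⊗₁ F.F₁ g) ∘ G.φ
        ≈⟨ pullˡ (Equiv.sym G.homomorphism) ⟩
      G.F₁ (F.φ ∘ (F.F₁ f ⊗₁ F.F₁ g)) ∘ G.φ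
        ≈⟨ ∘-resp-≈ˡ (Equiv.trans (G.F-resp-≈ F.φ-natural) G.homomorphism) ⟩
      (G.F₁ (F.F₁ (f ⊗₁ g)) ∘ G.F₁ F.φ) ∘ G.φ
        ≈⟨ assoc ⟩
      G.F₁ (F.F₁ (f ⊗₁ g)) ∘ G.F₁ F.φ ∘ G.φ ∎

    φ⊗id : ∀ {X Y Z W} {f : X ⇒ F.F₀ Y} {g : W ⇒ G.F₀ X} →
           G.φ ∘ ((G.F₁ f ∘ g) ⊗₁ id {G.F₀ Z}) ≈ G.F₁ (f ⊗₁ id) ∘ G.φ ∘ (g ⊗₁ id)
    φ⊗id {f = f} {g} = begin
      G.φ ∘ ((G.F₁ f ∘ g) ⊗₁ id)
        ≈⟨ ∘-resp-≈ʳ (⊗-resp-≈ Equiv.refl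
             (Equiv.trans (Equiv.sym identityˡ)
               (∘-resp-≈ˡ (Equiv.sym G.F-identity)))) ⟩
      G.φ ∘ ((G.F₁ f ∘ g) ⊗₁ (G.F₁ id ∘ id))
        ≈⟨ ∘-resp-≈ʳ ⊗-homomorphism ⟩
      G.φ ∘ (G.F₁ f ⊗₁ G.F₁ id) ∘ (g ⊗₁ id)
        ≈⟨ pullˡ G.φ-natural ⟩
      (G.F₁ (f ⊗₁ id) ∘ G.φ) ∘ (g ⊗₁ id)
        ≈⟨ assoc ⟩
      G.F₁ (f ⊗₁ id) ∘ G.φ ∘ (g ⊗₁ id) ∎

    φid⊗ : ∀ {X Y Z W} {f : X ⇒ F.F₀ Y} {g : W ⇒ G.F₀ X} →
           G.φ ∘ (id {G.F₀ Z} ⊗₁ (G.F₁ f ∘ g)) ≈ G.F₁ (id ⊗₁ f) ∘ G.φ ∘ (id ⊗₁ g)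
    φid⊗ {f = f} {g} = begin
      G.φ ∘ (id ⊗₁ (G.F₁ f ∘ g))
        ≈⟨ ∘-resp-≈ʳ (⊗-resp-≈
             (Equiv.trans (Equiv.sym identityˡ)
               (∘-resp-≈ˡ (Equiv.sym G.F-identity))) Equiv.refl) ⟩
      G.φ ∘ ((G.F₁ id ∘ id) ⊗₁ (G.F₁ f ∘ g))
        ≈⟨ ∘-resp-≈ʳ ⊗-homomorphism ⟩
      G.φ ∘ (G.F₁ id ⊗₁ G.F₁ f) ∘ (id ⊗₁ g)
        ≈⟨ pullˡ G.φ-natural ⟩
      (G.F₁ (id ⊗₁ f) ∘ G.φ) ∘ (id ⊗₁ g)
        ≈⟨ assoc ⟩
      G.F₁ (id ⊗₁ f) ∘ G.φ ∘ (id ⊗₁ g) ∎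

    fuse : ∀ {W X Y Z} {f : Y ⇒ Z} {g : X ⇒ Y} {h : W ⇒ X}
           {V} {k : V ⇒ G.F₀ W} →
           G.F₁ f ∘ G.F₁ g ∘ G.F₁ h ∘ k ≈ G.F₁ (f ∘ g ∘ h) ∘ k
    fuse {f = f} {g} {h} {k = k} = begin
      G.F₁ f ∘ G.F₁ g ∘ G.F₁ h ∘ k
        ≈⟨ ∘-resp-≈ʳ (pullˡ (Equiv.sym G.homomorphism)) ⟩
      G.F₁ f ∘ G.F₁ (g ∘ h) ∘ k
        ≈⟨ pullˡ (Equiv.sym G.homomorphism) ⟩
      G.F₁ (f ∘ g ∘ h) ∘ k ∎

    assoc-law : ∀ {X Y Z} →
      G.F₁ (F.F₁ (α {X} {Y} {Z})) ∘ (G.F₁ F.φ ∘ G.φ) ∘ ((G.F₁ F.φ ∘ G.φ) ⊗₁ id) ≈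
      (G.F₁ F.φ ∘ G.φ) ∘ (id ⊗₁ (G.F₁ F.φ ∘ G.φ)) ∘ α
    assoc-law = begin
      G.F₁ (F.F₁ α) ∘ (G.F₁ F.φ ∘ G.φ) ∘ ((G.F₁ F.φ ∘ G.φ) ⊗₁ id)
        ≈⟨ ∘-resp-≈ʳ (Equiv.trans assoc (∘-resp-≈ʳ φ⊗id)) ⟩
      G.F₁ (F.F₁ α) ∘ G.F₁ F.φ ∘ G.F₁ (F.φ ⊗₁ id) ∘ G.φ ∘ (G.φ ⊗₁ id)
        ≈⟨ fuse ⟩
      G.F₁ (F.F₁ α ∘ F.φ ∘ (F.φ ⊗₁ id)) ∘ G.φ ∘ (G.φ ⊗₁ id)
        ≈⟨ ∘-resp-≈ˡ (G.F-resp-≈ F.associativity) ⟩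
      G.F₁ (F.φ ∘ (id ⊗₁ F.φ) ∘ α) ∘ G.φ ∘ (G.φ ⊗₁ id)
        ≈⟨ Equiv.sym fuse ⟩
      G.F₁ F.φ ∘ G.F₁ (id ⊗₁ F.φ) ∘ G.F₁ α ∘ G.φ ∘ (G.φ ⊗₁ id)
        ≈⟨ ∘-resp-≈ʳ (∘-resp-≈ʳ G.associativity) ⟩
      G.F₁ F.φ ∘ G.F₁ (id ⊗₁ F.φ) ∘ G.φ ∘ (id ⊗₁ G.φ) ∘ α
        ≈⟨ ∘-resp-≈ʳ (∘-resp-≈ʳ (Equiv.sym assoc)) ⟩
      G.F₁ F.φ ∘ G.F₁ (id ⊗₁ F.φ) ∘ (G.φ ∘ (id ⊗₁ G.φ)) ∘ α
        ≈⟨ ∘-resp-≈ʳ (pullˡ (Equiv.sym φid⊗)) ⟩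
      G.F₁ F.φ ∘ (G.φ ∘ (id ⊗₁ (G.F₁ F.φ ∘ G.φ))) ∘ α
        ≈⟨ ∘-resp-≈ʳ assoc ⟩
      G.F₁ F.φ ∘ G.φ ∘ (id ⊗₁ (G.F₁ F.φ ∘ G.φ)) ∘ α
        ≈⟨ Equiv.sym assoc ⟩
      (G.F₁ F.φ ∘ G.φ) ∘ (id ⊗₁ (G.F₁ F.φ ∘ G.φ)) ∘ α ∎

    unitˡ-law : ∀ {X} →
      G.F₁ (F.F₁ (λ⇒ {X})) ∘ (G.F₁ F.φ ∘ G.φ) ∘ ((G.F₁ F.ε ∘ G.ε) ⊗₁ id) ≈ λ⇒
    unitˡ-law = begin
      G.F₁ (F.F₁ λ⇒) ∘ (G.F₁ F.φ ∘ G.φ) ∘ ((G.F₁ F.ε ∘ G.ε) ⊗₁ id)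
        ≈⟨ ∘-resp-≈ʳ (Equiv.trans assoc (∘-resp-≈ʳ φ⊗id)) ⟩
      G.F₁ (F.F₁ λ⇒) ∘ G.F₁ F.φ ∘ G.F₁ (F.ε ⊗₁ id) ∘ G.φ ∘ (G.ε ⊗₁ id)
        ≈⟨ fuse ⟩
      G.F₁ (F.F₁ λ⇒ ∘ F.φ ∘ (F.ε ⊗₁ id)) ∘ G.φ ∘ (G.ε ⊗₁ id)
        ≈⟨ ∘-resp-≈ˡ (G.F-resp-≈ F.unitaryˡ) ⟩
      G.F₁ λ⇒ ∘ G.φ ∘ (G.ε ⊗₁ id)
        ≈⟨ G.unitaryˡ ⟩
      λ⇒ ∎

    unitʳ-law : ∀ {X} →
      G.F₁ (F.F₁ (ρ⇒ {X})) ∘ (G.F₁ F.φ ∘ G.φ) ∘ (id ⊗₁ (G.F₁ F.ε ∘ G.ε)) ≈ ρ⇒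
    unitʳ-law = begin
      G.F₁ (F.F₁ ρ⇒) ∘ (G.F₁ F.φ ∘ G.φ) ∘ (id ⊗₁ (G.F₁ F.ε ∘ G.ε))
        ≈⟨ ∘-resp-≈ʳ (Equiv.trans assoc (∘-resp-≈ʳ φid⊗)) ⟩
      G.F₁ (F.F₁ ρ⇒) ∘ G.F₁ F.φ ∘ G.F₁ (id ⊗₁ F.ε) ∘ G.φ ∘ (id ⊗₁ G.ε)
        ≈⟨ fuse ⟩
      G.F₁ (F.F₁ ρ⇒ ∘ F.φ ∘ (id ⊗₁ F.ε)) ∘ G.φ ∘ (id ⊗₁ G.ε)
        ≈⟨ ∘-resp-≈ˡ (G.F-resp-≈ F.unitaryʳ) ⟩
      G.F₁ ρ⇒ ∘ G.φ ∘ (id ⊗₁ G.ε)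
        ≈⟨ G.unitaryʳ ⟩
      ρ⇒ ∎

  record MonoidalNaturalIsomorphism (F G : SymmetricMonoidalEndofunctor) :
         Set (o ⊔ ℓ ⊔ e) where
    private
      module F = SymmetricMonoidalEndofunctor F
      module G = SymmetricMonoidalEndofunctor G
    field
      iso : ∀ X → F.F₀ X ≅ G.F₀ X

    η : ∀ X → F.F₀ X ⇒ G.F₀ X
    η X = from (iso X)

    field
      natural  : ∀ {X Y} {f : X ⇒ Y} → η Y ∘ F.F₁ f ≈ G.F₁ f ∘ η X
      monoidal : ∀ {X Y} → η (X ⊗₀ Y) ∘ F.φ ≈ G.φ ∘ (η X ⊗₁ η Y)
      unital   : η unit ∘ F.ε ≈ G.ε

  -- A strong monoidal functor from the discrete monoidal category (ℝ, +, 0)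
  -- to symmetric monoidal endofunctors under composition, written out.  The
  -- morphisms of the discrete category are proofs of ≈ℝ, any two of which
  -- are equal; the associator and unitors of the target are identities.
  record ShiftFunctor : Set (o ⊔ ℓ ⊔ e) where
    field
      Shift : ℝ → SymmetricMonoidalEndofunctor

    Shift₀ : ℝ → Obj → Obj
    Shift₀ d = F₀ (Shift d)

    Shift₁ : ∀ d {X Y} → X ⇒ Y → Shift₀ d X ⇒ Shift₀ d Y
    Shift₁ d = F₁ (Shift d)

    field
      shift-≈ : ∀ {d d′} → d ≈ℝ d′ → MonoidalNaturalIsomorphism (Shift d) (Shift d′)
      shift-0 : MonoidalNaturalIsomorphism (Shift 0ℝ) idF
      shift-+ : ∀ d₁ d₂ →
                MonoidalNaturalIsomorphism (Shift (d₁ +ℝ d₂)) (Shift d₁ ∘F Shift d₂)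

    ⟨_⟩≈ : ∀ {d d′} → d ≈ℝ d′ → ∀ X → Shift₀ d X ⇒ Shift₀ d′ X
    ⟨ p ⟩≈ = MonoidalNaturalIsomorphism.η (shift-≈ p)

    ζ : ∀ X → Shift₀ 0ℝ X ⇒ X
    ζ = MonoidalNaturalIsomorphism.η shift-0

    δ : ∀ d₁ d₂ X → Shift₀ (d₁ +ℝ d₂) X ⇒ Shift₀ d₁ (Shift₀ d₂ X)
    δ d₁ d₂ = MonoidalNaturalIsomorphism.η (shift-+ d₁ d₂)

    field
      shift-≈-irrelevant : ∀ {d d′} (p q : d ≈ℝ d′) {X} → ⟨ p ⟩≈ X ≈ ⟨ q ⟩≈ X
      shift-≈-refl       : ∀ {d X} → ⟨ ≈ℝ-refl {d} ⟩≈ X ≈ id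
      shift-≈-trans      : ∀ {d d′ d″} (p : d ≈ℝ d′) (q : d′ ≈ℝ d″) {X} →
                           ⟨ ≈ℝ-trans p q ⟩≈ X ≈ ⟨ q ⟩≈ X ∘ ⟨ p ⟩≈ X

      shift-+-natural    : ∀ {d₁ d₁′ d₂ d₂′} (p : d₁ ≈ℝ d₁′) (q : d₂ ≈ℝ d₂′) {X} →
                           δ d₁′ d₂′ X ∘ ⟨ +ℝ-cong p q ⟩≈ X ≈
                           (⟨ p ⟩≈ (Shift₀ d₂′ X) ∘ Shift₁ d₁ (⟨ q ⟩≈ X)) ∘ δ d₁ d₂ X
      shift-+-assoc      : ∀ {d₁ d₂ d₃ X} →
                           δ d₁ d₂ (Shift₀ d₃ X) ∘ δ (d₁ +ℝ d₂) d₃ X ≈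
                           Shift₁ d₁ (δ d₂ d₃ X) ∘ δ d₁ (d₂ +ℝ d₃) X ∘
                             ⟨ +ℝ-assoc d₁ d₂ d₃ ⟩≈ X
      shift-+-identityˡ  : ∀ {d X} →
                           ζ (Shift₀ d X) ∘ δ 0ℝ d X ≈ ⟨ +ℝ-identityˡ d ⟩≈ X
      shift-+-identityʳ  : ∀ {d X} →
                           Shift₁ d (ζ X) ∘ δ d 0ℝ X ≈ ⟨ +ℝ-identityʳ d ⟩≈ X

record Signature (a b : Level) : Set (lsuc (a ⊔ b)) where
  field
    Qubit      : Set a
    Gate       : Set b
    arity      : Gate → ℕ
    qubits     : (G : Gate) → Vec Qubit (arity G)
    distinct   : (G : Gate) → Unique (qubits G)
    duration   : Gate → ℝ
    duration≥0 : (G : Gate) → 0≤ℝ duration G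

module Syntax {a b} (S : Signature a b) where
  open Signature S

  infixr 7 _⊗_
  data Type : Set a where
    𝟙   : Type
    qb  : Qubit → Type
    _⊗_ : Type → Type → Type
    □   : ℝ → Type → Type

  Variable : Set
  Variable = ℕ

  infix 6 _∶[_]_
  record Declaration : Set a where
    constructor _∶[_]_
    field
      name  : Variable
      grade : ℝ
      type  : Type

  Context : Set a
  Context = List Declaration

  infixr 6 _+ᶜ_
  _+ᶜ_ : ℝ → Context → Context
  d +ᶜ Γ = map (λ (x ∶[ e ] A) → x ∶[ d +ℝ e ] A) Γ

  data NormalTerm : Set where
    ⋆     : NormalTerm
    var   : Variable → NormalTerm
    _,ₜ_  : NormalTerm → NormalTerm → NormalTerm
    box   : ℝ → NormalTerm → NormalTerm

  -- Equality of syntax, i.e. syntactic identity except that real numbers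
  -- are compared with ≈ℝ.

  infix 4 _≈ᵀ_ _≈ᴰ_ _≈ᶜ_ _≈ᵗ_
  data _≈ᵀ_ : Type → Type → Set a where
    𝟙   : 𝟙 ≈ᵀ 𝟙
    qb  : ∀ {q} → qb q ≈ᵀ qb q
    _⊗_ : ∀ {A A′ B B′} → A ≈ᵀ A′ → B ≈ᵀ B′ → A ⊗ B ≈ᵀ A′ ⊗ B′
    □   : ∀ {d d′ A A′} → d ≈ℝ d′ → A ≈ᵀ A′ → □ d A ≈ᵀ □ d′ A′

  data _≈ᴰ_ : Declaration → Declaration → Set a where
    decl : ∀ {x d d′ A A′} → d ≈ℝ d′ → A ≈ᵀ A′ → x ∶[ d ] A ≈ᴰ x ∶[ d′ ] A′

  _≈ᶜ_ : Context → Context → Set a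
  _≈ᶜ_ = Pointwise _≈ᴰ_

  data _≈ᵗ_ : NormalTerm → NormalTerm → Set where
    ⋆    : ⋆ ≈ᵗ ⋆
    var  : ∀ {x} → var x ≈ᵗ var x
    _,ₜ_ : ∀ {s s′ t t′} → s ≈ᵗ s′ → t ≈ᵗ t′ → (s ,ₜ t) ≈ᵗ (s′ ,ₜ t′)
    box  : ∀ {d d′ t t′} → d ≈ℝ d′ → t ≈ᵗ t′ → box d t ≈ᵗ box d′ t′

  infix 3 _⊢ₙ_∶_
  data _⊢ₙ_∶_ : Context → NormalTerm → Type → Set a where
    ⊢⋆    : [] ⊢ₙ ⋆ ∶ 𝟙
    ⊢var  : ∀ {x q} → (x ∶[ 0ℝ ] qb q) ∷ [] ⊢ₙ var x ∶ qb q
    ⊢pair : ∀ {Γ Δ s t A B} → Γ ⊢ₙ s ∶ A → Δ ⊢ₙ t ∶ B →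
            Γ ++ Δ ⊢ₙ (s ,ₜ t) ∶ A ⊗ B
    ⊢box  : ∀ {d Γ t A} → Γ ⊢ₙ t ∶ A → d +ᶜ Γ ⊢ₙ box d t ∶ □ d A
    -- Makes the judgement well defined on real numbers rather than on the
    -- Cauchy sequences representing them.
    ⊢resp : ∀ {Γ Γ′ t t′ A A′} → Γ ≈ᶜ Γ′ → t ≈ᵗ t′ → A ≈ᵀ A′ →
            Γ ⊢ₙ t ∶ A → Γ′ ⊢ₙ t′ ∶ A′

record Model {a b} (S : Signature a b) (o ℓ e : Level) :
       Set (a ⊔ b ⊔ lsuc (o ⊔ ℓ ⊔ e)) where
  open Signature S
  field
    C : SymmetricMonoidalCategory o ℓ e

  open SymmetricMonoidalCategory C public
  open Endofunctors C public

  field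
    X            : Qubit → Obj
    shiftFunctor : ShiftFunctor

  open ShiftFunctor shiftFunctor public

  field
    gate  : (G : Gate) →
            Shift₀ (-ℝ duration G) (⨂ (Vec.map X (qubits G))) ⇒
            ⨂ (Vec.map X (qubits G))
    delay : ∀ x q → Shift₀ (-ℝ x) (X q) ⇒ X q
    delay-resp-≈ : ∀ {x y} (p : x ≈ℝ y) {q} →
                   delay y q ∘ ⟨ -ℝ-cong p ⟩≈ (X q) ≈ delay x q

module Interpretation {a b} {S : Signature a b} {o ℓ e} (M : Model S o ℓ e) where
  open Syntax S
  open Model M

  ⟦_⟧ : Type → Obj
  ⟦ 𝟙 ⟧     = unit
  ⟦ qb q ⟧  = X q
  ⟦ A ⊗ B ⟧ = ⟦ A ⟧ ⊗₀ ⟦ B ⟧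
  ⟦ □ d A ⟧ = Shift₀ d ⟦ A ⟧

  ⟦_⟧ᶜ : Context → Obj
  ⟦ [] ⟧ᶜ               = unit
  ⟦ (_ ∶[ d ] A) ∷ Γ ⟧ᶜ = Shift₀ d ⟦ A ⟧ ⊗₀ ⟦ Γ ⟧ᶜ

  private module Nat = MonoidalNaturalIsomorphism
  private module SME = SymmetricMonoidalEndofunctor

  -- The coherence isomorphisms of a model: those generated by the monoidal
  -- structure and by the structure isomorphisms of Shift.  The braiding is
  -- deliberately not a generator, since it permutes tensor factors.
  data Coherent : ∀ {Y Z} → Y ≅ Z → Set (o ⊔ ℓ ⊔ e) where
    c-refl  : ∀ {Y} → Coherent (≅-refl {Y})
    c-sym   : ∀ {Y Z} {i : Y ≅ Z} → Coherent i → Coherent (≅-sym i)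
    c-trans : ∀ {Y Z W} {i : Y ≅ Z} {j : Z ≅ W} →
              Coherent i → Coherent j → Coherent (≅-trans i j)
    c-⊗     : ∀ {Y Y′ Z Z′} {i : Y ≅ Y′} {j : Z ≅ Z′} →
              Coherent i → Coherent j → Coherent (i ⊗ᵢ j)
    c-Shift : ∀ d {Y Z} {i : Y ≅ Z} → Coherent i → Coherent (SME.Fᵢ (Shift d) i)

    c-associator : ∀ Y Z W → Coherent (associator Y Z W)
    c-unitorˡ    : ∀ Y → Coherent (unitorˡ Y)
    c-unitorʳ    : ∀ Y → Coherent (unitorʳ Y)

    c-Shift-unit : ∀ d → Coherent (SME.ε-iso (Shift d))
    c-Shift-⊗    : ∀ d Y Z → Coherent (SME.φ-iso (Shift d) Y Z)
    c-shift-0    : ∀ Y → Coherent (Nat.iso shift-0 Y)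
    c-shift-+    : ∀ d₁ d₂ Y → Coherent (Nat.iso (shift-+ d₁ d₂) Y)
    c-shift-≈    : ∀ {d d′} (p : d ≈ℝ d′) Y → Coherent (Nat.iso (shift-≈ p) Y)

  -- Equality of objects up to the coherence isomorphisms that are left
  -- implicit on paper.  Equality on the nose fails already for a single
  -- variable, where it reads  Shift₀ 0ℝ (X q) ⊗₀ unit = X q.
  infix 4 _≃_
  _≃_ : Obj → Obj → Set (o ⊔ ℓ ⊔ e)
  Y ≃ Z = ∃[ i ] Coherent {Y} {Z} i

{-# OPTIONS --safe #-}
module Submission where

open import Defs
open import Data.List.Base using ([]; _∷_; _++_)
open import Data.List.Relation.Binary.Pointwise.Base using ([]; _∷_)
open import Data.Product.Base using (_,_)

module _ {a b o ℓ e} {S : Signature a b} (M : Model S o ℓ e) where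
  open Syntax S
  open Model M
  open Interpretation M

  ≃-refl : ∀ {Y} → Y ≃ Y
  ≃-refl = _ , c-refl

  ≃-sym : ∀ {Y Z} → Y ≃ Z → Z ≃ Y
  ≃-sym (_ , i) = _ , c-sym i

  ≃-trans : ∀ {Y Z W} → Y ≃ Z → Z ≃ W → Y ≃ W
  ≃-trans (_ , i) (_ , j) = _ , c-trans i j

  ⊗₀-cong : ∀ {Y Y′ Z Z′} → Y ≃ Y′ → Z ≃ Z′ → Y ⊗₀ Z ≃ Y′ ⊗₀ Z′
  ⊗₀-cong (_ , i) (_ , j) = _ , c-⊗ i j

  Shift₀-cong : ∀ {d d′ Y Z} → d ≈ℝ d′ → Y ≃ Z → Shift₀ d Y ≃ Shift₀ d′ Z
  Shift₀-cong {d} p (_ , i) = _ , c-trans (c-Shift d i) (c-shift-≈ p _)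

  ⟦⟧-cong : ∀ {A B} → A ≈ᵀ B → ⟦ A ⟧ ≃ ⟦ B ⟧
  ⟦⟧-cong 𝟙       = ≃-refl
  ⟦⟧-cong qb      = ≃-refl
  ⟦⟧-cong (p ⊗ q) = ⊗₀-cong (⟦⟧-cong p) (⟦⟧-cong q)
  ⟦⟧-cong (□ p q) = Shift₀-cong p (⟦⟧-cong q)

  ⟦⟧ᶜ-cong : ∀ {Γ Δ} → Γ ≈ᶜ Δ → ⟦ Γ ⟧ᶜ ≃ ⟦ Δ ⟧ᶜ
  ⟦⟧ᶜ-cong []              = ≃-refl
  ⟦⟧ᶜ-cong (decl p q ∷ ps) = ⊗₀-cong (Shift₀-cong p (⟦⟧-cong q)) (⟦⟧ᶜ-cong ps)

  ⟦++⟧ᶜ : ∀ Γ Δ → ⟦ Γ ++ Δ ⟧ᶜ ≃ ⟦ Γ ⟧ᶜ ⊗₀ ⟦ Δ ⟧ᶜ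
  ⟦++⟧ᶜ []                 Δ = ≃-sym (_ , c-unitorˡ _)
  ⟦++⟧ᶜ ((_ ∶[ _ ] _) ∷ Γ) Δ =
    ≃-trans (⊗₀-cong ≃-refl (⟦++⟧ᶜ Γ Δ)) (≃-sym (_ , c-associator _ _ _))

  ⟦+ᶜ⟧ᶜ : ∀ d Γ → ⟦ d +ᶜ Γ ⟧ᶜ ≃ Shift₀ d ⟦ Γ ⟧ᶜ
  ⟦+ᶜ⟧ᶜ d []                 = _ , c-Shift-unit d
  ⟦+ᶜ⟧ᶜ d ((_ ∶[ c ] _) ∷ Γ) =
    ≃-trans (⊗₀-cong (_ , c-shift-+ d c _) (⟦+ᶜ⟧ᶜ d Γ)) (_ , c-Shift-⊗ d _ _)

  normal-≃ : ∀ {Γ t A} → Γ ⊢ₙ t ∶ A → ⟦ Γ ⟧ᶜ ≃ ⟦ A ⟧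
  normal-≃ ⊢⋆                      = ≃-refl
  normal-≃ ⊢var                    = ≃-trans (_ , c-unitorʳ _) (_ , c-shift-0 _)
  normal-≃ (⊢pair {Γ} {Δ} ⊢s ⊢t)   =
    ≃-trans (⟦++⟧ᶜ Γ Δ) (⊗₀-cong (normal-≃ ⊢s) (normal-≃ ⊢t))
  normal-≃ (⊢box {d} {Γ} ⊢t)       =
    ≃-trans (⟦+ᶜ⟧ᶜ d Γ) (Shift₀-cong ≈ℝ-refl (normal-≃ ⊢t))
  normal-≃ (⊢resp Γ≈Γ′ _ A≈A′ ⊢t)  =
    ≃-trans (≃-sym (⟦⟧ᶜ-cong Γ≈Γ′)) (≃-trans (normal-≃ ⊢t) (⟦⟧-cong A≈A′))

lemma19 : ∀ {a b o ℓ e} (S : Signature a b) (M : Model S o ℓ e) →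
    let open Syntax S
        open Interpretation M
    in ∀ {Γ : Context} {t : NormalTerm} {A : Type} →
       Γ ⊢ₙ t ∶ A → ⟦ Γ ⟧ᶜ ≃ ⟦ A ⟧
lemma19 S M = normal-≃ M
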